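{- Let the initial vertex graph $G$ be given by its $n\times n$ 0-1 vertex adjacency matrix $E=(e_{ij})$, let $R=(r_{ij})$ be a quasicanonical matrix of order $N=n+s_q$ obtained from $E$ by quasinormalization, and let $H_q$ be the edge graph with edge adjacency matrix $R$; suppose $H_q$ is connected. Then $\nu(H_q)=\nu(G)$ if and only if all vertices of $H_q$ are simple, or, equivalently, for every pair $(x,y)$ with $r_{xy}=1$ the following holds: if $\sum_{i=1}^{N} r_{iy}>1$ then $\sum_{j=1}^{N} r_{xj}=1$, and if $\sum_{j=1}^{N} r_{xj}>1$ then $\sum_{i=1}^{N} r_{iy}=1$.
   Context: A vertex graph with 0-1 adjacency matrix $M=(m_{ij})$ of order $k$ has $k$ vertices and an edge from vertex $i$ to vertex $j$ iff $m_{ij}=1$ (loops allowed). The cyclomatic number $\nu$ of a directed graph is (number of edges) $-$ (number of vertices) $+$ (number of connected components, ignoring orientation). The matrix $C(M)$: put $s_{ij}=m_{ij}\left(\sum_{a} m_{aj}+\sum_{b} m_{ib}\right)$. For $(i,j)$ with $m_{ij}=1$ put $c_{ij}=\left(s_{ij}-\min\{s_{ib}: s_{ib}\neq 0\}\right)+\left(s_{ij}-\min\{s_{aj}: s_{aj}\ne 0\}\right)$ (minima over $b$ in row $i$, resp. over $a$ in column $j$); if $m_{ij}=0$ put $c_{ij}=0$. Then $C(M)=(c_{ij})$. A 0-1 matrix $M$ is quasicanonical if $C(M)=0$ and, for every $(i,j)$ with $m_{ij}=1$, the matrix $M^{(i,j)}$ obtained by deleting row $i$ and column $j$ satisfies $C(M^{(i,j)})=0$.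 An entry $m_{ij}=1$ fails the quasicanonicity conditions in $M$ if $c_{ij}\ne 0$ or $C(M^{(i,j)})\ne0$. $\Delta n$-transformation of an entry $m_{xy}=1$ of a $k\times k$ 0-1 matrix $M$: add a new row and column with index $k+1$, replace the entry $(x,y)$ by $0$, set the entries $(x,k+1)$ and $(k+1,y)$ equal to $1$, all other entries of the new row and column to $0$, and leave all other entries unchanged. Quasinormalization: a finite sequence of $\Delta n$-transformations, each applied to an entry equal to $1$ which fails the quasicanonicity conditions in the current matrix, ending with a quasicanonical matrix. Edge graph with edge adjacency matrix $R$ of order $N$: a directed graph with edges $q_1,\dots,q_N$ (loops and parallel edges not excluded) such that $r_{ij}=1$ iff the end of $q_i$ is the beginning of $q_j$. Convention: there are no isolated vertices; each edge $q_j$ with zero column $j$ begins in its own initial vertex, and each edge $q_i$ with zero row $i$ ends in its own final vertex (initial and final vertices are each incident to only that one edge). Every other vertex $v_h$ corresponds to the all-ones $k\times p$ submatrix of $R$ whose rows are the $k\geq1$ edges ending in $v_h$ and whose columns are the $p\ge1$ edges beginning in $v_h$. Such a vertex is simple if $k=1$ or $p=1$, and complicated if $k\ge2$ and $p\ge2$; initial and final vertices are not complicated and count as simple. -}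

module Defs where

open import Algebra.Properties.CommutativeMonoid.Sum using (sum)
open import Data.Bool.Base using (Bool; true; false; if_then_else_; not; _∧_)
import Data.Bool.Properties as Bool
open import Data.Empty using (⊥-elim)
open import Data.Fin.Base using (Fin; zero; suc; punchIn; punchOut)
open import Data.Fin.Properties using (_≟_; punchOut-cong; punchOut-injective; punchOut-punchIn; punchInᵢ≢i)
open import Data.Fin.Relation.Unary.Top using (view; ‵fromℕ; ‵inject₁)
open import Data.Integer.Base as ℤ using (ℤ)
open import Data.List.Base using (List; allFin; cartesianProduct; filter; length; lookup; map)
open import Data.List.Extrema.Nat using (min)
open import Data.Nat.Base using (ℕ; zero; suc; pred; _+_; _*_; _∸_)
import Data.Nat.Properties as ℕ
open import Data.Product.Base using (_×_; _,_; ∃; proj₁; proj₂)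
open import Data.Sum.Base using (_⊎_; inj₁; inj₂)
open import Function.Base using (id; _∘_)
open import Function.Bundles using (_⇔_; mk⇔; Equivalence)
open import Function.Definitions using (StrictlySurjective)
open import Relation.Binary.Construct.Closure.Equivalence as Eq using (EqClosure)
open import Relation.Binary.PropositionalEquality
  using (_≡_; _≢_; refl; sym; trans; cong; isEquivalence)
open import Relation.Nullary using (¬_; Dec; yes; no; does; ¬?)

∑ : ∀ {k} → (Fin k → ℕ) → ℕ
∑ = sum ℕ.+-0-commutativeMonoid

-- The entry 1 is `true` and the entry 0 is `false`.
Matrix : ℕ → Set
Matrix k = Fin k → Fin k → Bool

⟦_⟧ : Bool → ℕ
⟦ b ⟧ = if b then 1 else 0

rowSum : ∀ {k} → Matrix k → Fin k → ℕ
rowSum M i = ∑ λ b → ⟦ M i b ⟧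

colSum : ∀ {k} → Matrix k → Fin k → ℕ
colSum M j = ∑ λ a → ⟦ M a j ⟧

s : ∀ {k} → Matrix k → Fin k → Fin k → ℕ
s M i j = ⟦ M i j ⟧ * (colSum M j + rowSum M i)

-- The first argument of `min` is the value for an empty list.  In `C` it
-- is s_ij with m_ij = 1, which is itself one of the nonzero values, so it
-- does not affect the minimum.
minNonzero : ∀ {k} → ℕ → (Fin k → ℕ) → ℕ
minNonzero default f = min default (filter (λ x → ¬? (x ℕ.≟ 0)) (map f (allFin _)))

-- Truncated subtraction is exact here: both minima are at most s_ij.
C : ∀ {k} → Matrix k → Fin k → Fin k → ℕ
C M i j =
  if M i j
  then (s M i j ∸ minNonzero (s M i j) (λ b → s M i b))
     + (s M i j ∸ minNonzero (s M i j) (λ a → s M a j))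
  else 0

C≡0 : ∀ {k} → Matrix k → Set
C≡0 M = ∀ i j → C M i j ≡ 0

minor : ∀ {k} → Matrix k → Fin k → Fin k → Matrix (pred k)
minor {suc k} M i j a b = M (punchIn i a) (punchIn j b)

Quasicanonical : ∀ {k} → Matrix k → Set
Quasicanonical M = C≡0 M × (∀ i j → M i j ≡ true → C≡0 (minor M i j))

Fails : ∀ {k} → Matrix k → Fin k → Fin k → Set
Fails M i j = M i j ≡ true × (C M i j ≢ 0 ⊎ ¬ C≡0 (minor M i j))

-- The new index is the last one, `fromℕ k`; an old index i is `inject₁ i`.
Δn : ∀ {k} → Matrix k → Fin k → Fin k → Matrix (suc k)
Δn M x y a b with view a | view b
... | ‵inject₁ i | ‵inject₁ j = M i j ∧ not (does (i ≟ x) ∧ does (j ≟ y))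
... | ‵inject₁ i | ‵fromℕ     = does (i ≟ x)
... | ‵fromℕ     | ‵inject₁ j = does (j ≟ y)
... | ‵fromℕ     | ‵fromℕ     = false

-- `ΔnSequence E t M`: M arises from E by t successive Δn-transformations
-- of failing entries.
data ΔnSequence {n} (E : Matrix n) : (t : ℕ) → Matrix (t + n) → Set where
  start : ΔnSequence E 0 E
  step  : ∀ {t} {M : Matrix (t + n)} → ΔnSequence E t M →
          ∀ x y → Fails M x y → ΔnSequence E (suc t) (Δn M x y)

Quasinormalization : ∀ {n} (E : Matrix n) (t : ℕ) → Matrix (t + n) → Set
Quasinormalization E t R = ΔnSequence E t R × Quasicanonical R

-- Vertices Fin V, edges Fin m; loops and parallel edges are allowed.
record Digraph (V m : ℕ) : Set where
  field
    source target : Fin m → Fin V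

open Digraph public

module _ {V m : ℕ} (G : Digraph V m) where

  Adjacent : Fin V → Fin V → Set
  Adjacent u v = ∃ λ e → source G e ≡ u × target G e ≡ v

  Joined : Fin V → Fin V → Set
  Joined = EqClosure Adjacent

  Connected : Set
  Connected = ∀ u v → Joined u v

  record Components : Set where
    field
      count            : ℕ
      label            : Fin V → Fin count
      label-surjective : StrictlySurjective _≡_ label
      label-correct    : ∀ u v → label u ≡ label v ⇔ Joined u v

-- Existence of the components, by adding the edges one at a time.
private
  dropEdge : ∀ {V m} → Digraph V (suc m) → Digraph V m
  dropEdge G = record { source = source G ∘ suc ; target = target G ∘ suc }

  module AddEdge {V m} (G : Digraph V (suc m)) where

    a b : Fin V
    a = source G zero
    b = target G zero

    a~b : Joined G a b
    a~b = Eq.return (zero , refl , refl)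

    weaken : ∀ {u v} → Joined (dropEdge G) u v → Joined G u v
    weaken = Eq.map λ (e , p , q) → suc e , p , q

    complete : ∀ {A : Set} (f : Fin V → A) → f a ≡ f b →
               (∀ {u v} → Joined (dropEdge G) u v → f u ≡ f v) →
               ∀ {u v} → Joined G u v → f u ≡ f v
    complete f fa≡fb old = Eq.gfold isEquivalence f edge
      where
      edge : ∀ {u v} → Adjacent G u v → f u ≡ f v
      edge (zero  , refl , refl) = fa≡fb
      edge (suc e , p    , q)    = old (Eq.return (e , p , q))

    addEdge : Components (dropEdge G) → Components G
    addEdge record { count = zero ; label = l } with () ← l a
    addEdge record { count = suc c ; label = l ; label-surjective = surj ; label-correct = corr }
      with l a ≟ l b
    ... | yes la≡lb = record
      { count            = suc c
      ; label            = l
      ; label-surjective = surj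
      ; label-correct    = λ u v → mk⇔
          (weaken ∘ Equivalence.to (corr u v))
          (complete l la≡lb (Equivalence.from (corr _ _)))
      }
    ... | no la≢lb = record
      { count            = c
      ; label            = merge ∘ l
      ; label-surjective = merged-surjective
      ; label-correct    = λ u v → mk⇔ sound
          (complete (merge ∘ l) merge-ab (cong merge ∘ Equivalence.from (corr _ _)))
      }
      where
      redirect : ∀ {x} → Dec (x ≡ l b) → Fin (suc c)
      redirect (yes _) = l a
      redirect {x} (no _)  = x

      redirect≢ : ∀ {x} (d : Dec (x ≡ l b)) → l b ≢ redirect d
      redirect≢ (yes _) = la≢lb ∘ sym
      redirect≢ (no p)  = p ∘ sym

      merge : Fin (suc c) → Fin c
      merge x = punchOut (redirect≢ (x ≟ l b))

      redirect-b : (d : Dec (l b ≡ l b)) → redirect d ≡ l a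
      redirect-b (yes _) = refl
      redirect-b (no p)  = ⊥-elim (p refl)

      redirect-other : ∀ {x} → x ≢ l b → (d : Dec (x ≡ l b)) → redirect d ≡ x
      redirect-other p (yes q) = ⊥-elim (p q)
      redirect-other p (no _)  = refl

      merge-ab : merge (l a) ≡ merge (l b)
      merge-ab = punchOut-cong (l b)
        (trans (redirect-other la≢lb (l a ≟ l b)) (sym (redirect-b (l b ≟ l b))))

      merged-surjective : StrictlySurjective _≡_ (merge ∘ l)
      merged-surjective x with surj (punchIn (l b) x)
      ... | v , lv≡ = v , trans
        (punchOut-cong (l b) (trans (redirect-other lv≢lb (l v ≟ l b)) lv≡))
        (punchOut-punchIn (l b))
        where
        lv≢lb : l v ≢ l b
        lv≢lb p = punchInᵢ≢i (l b) x (trans (sym lv≡) p)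

      representative : ∀ u (d : Dec (l u ≡ l b)) →
                       ∃ λ u′ → l u′ ≡ redirect d × Joined G u u′
      representative u (yes p) = a , refl ,
        Eq.transitive _ (weaken (Equivalence.to (corr u b) p)) (Eq.symmetric _ a~b)
      representative u (no _)  = u , refl , Eq.reflexive _

      sound : ∀ {u v} → merge (l u) ≡ merge (l v) → Joined G u v
      sound {u} {v} p
        with representative u (l u ≟ l b) | representative v (l v ≟ l b)
      ... | u′ , lu′ , u~u′ | v′ , lv′ , v~v′ =
        Eq.transitive _ u~u′ (Eq.transitive _
          (weaken (Equivalence.to (corr u′ v′)
            (trans lu′ (trans (punchOut-injective (redirect≢ (l u ≟ l b)) (redirect≢ (l v ≟ l b)) p) (sym lv′)))))
          (Eq.symmetric _ v~v′))

components : ∀ {V m} (G : Digraph V m) → Components G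
components {V} {zero} G = record
  { count            = V
  ; label            = id
  ; label-surjective = λ v → v , refl
  ; label-correct    = λ u v → mk⇔ (λ { refl → Eq.reflexive _ })
      (Eq.fold isEquivalence λ { (() , _) })
  }
components {V} {suc m} G = AddEdge.addEdge G (components (dropEdge G))

ν : ∀ {V m} → Digraph V m → ℤ
ν {V} {m} G = ℤ.+ m ℤ.- ℤ.+ V ℤ.+ ℤ.+ Components.count (components G)

ones : ∀ {k} → Matrix k → List (Fin k × Fin k)
ones M = filter (λ (i , j) → M i j Bool.≟ true) (cartesianProduct (allFin _) (allFin _))

vertexGraph : ∀ {k} (M : Matrix k) → Digraph k (length (ones M))
vertexGraph M = record
  { source = proj₁ ∘ lookup (ones M)
  ; target = proj₂ ∘ lookup (ones M)
  }

module _ {V N : ℕ} (H : Digraph V N) where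

  Incident : Fin N → Fin V → Set
  Incident e v = source H e ≡ v ⊎ target H e ≡ v

  inDegree outDegree : Fin V → ℕ
  inDegree  v = ∑ λ e → ⟦ does (target H e ≟ v) ⟧
  outDegree v = ∑ λ e → ⟦ does (source H e ≟ v) ⟧

  -- In an edge graph the vertices with inDegree 0 are the initial ones and
  -- those with outDegree 0 the final ones.  For every other vertex,
  -- inDegree = k and outDegree = p are the numbers of rows and columns of
  -- its all-ones submatrix.
  Initial Final Simple : Fin V → Set
  Initial v = inDegree v ≡ 0
  Final   v = outDegree v ≡ 0
  Simple  v = Initial v ⊎ Final v ⊎ inDegree v ≡ 1 ⊎ outDegree v ≡ 1

record IsEdgeGraph {V N} (R : Matrix N) (H : Digraph V N) : Set where
  field
    adjacency      : ∀ i j → R i j ≡ true ⇔ target H i ≡ source H j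
    noIsolated     : ∀ v → ∃ λ e → Incident H e v
    initialPrivate : ∀ j → (∀ i → R i j ≡ false) →
                     ∀ e → Incident H e (source H j) → e ≡ j
    finalPrivate   : ∀ i → (∀ j → R i j ≡ false) →
                     ∀ e → Incident H e (target H i) → e ≡ i

{-# OPTIONS --safe #-}
module Submission where

-- Subdividing an edge adds one edge and one vertex and keeps the components,
-- so ν(G) is the cyclomatic number of the vertex graph of R.  That graph has
-- N vertices, as many components as H_q, and Σ_v in(v) out(v) edges, because
-- its edges are the pairs of consecutive edges of H_q.  As
-- N = Σ_v in(v) = Σ_v out(v), the two cyclomatic numbers differ by
-- Σ_v (in(v) - 1)(out(v) - 1).  Every term is nonnegative, since an initial
-- vertex has out(v) = 1 and a final one in(v) = 1, and vanishes exactly at the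
-- simple vertices.

open import Defs
open import Data.Bool.Base using (Bool; true; false; not; _∧_)
import Data.Bool.Properties as Bool
open import Data.Fin.Base using (Fin; zero; suc; fromℕ; inject₁)
open import Data.Fin.Properties using (_≟_; any?; injective⇒≤)
open import Data.Fin.Relation.Unary.Top using (view; view-fromℕ; view-inject₁; ‵fromℕ; ‵inject₁)
import Data.Integer.Base as ℤ
import Data.Integer.Properties as ℤ
import Data.Integer.Tactic.RingSolver as ℤ-Solver
open import Data.List.Base using (_++_; allFin; cartesianProduct; filter; length; map; tabulate)
open import Data.List.Membership.Propositional.Properties
  using (∈-allFin; ∈-cartesianProduct⁺; ∈-filter⁺; ∈-filter⁻; ∈-lookup)
open import Data.List.Properties using (filter-++; length-++; map-tabulate)
open import Data.List.Relation.Unary.Any using (index)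
open import Data.List.Relation.Unary.Any.Properties using (lookup-index)
open import Data.Nat.Base using (ℕ; zero; suc; pred; _+_; _*_; _≤_; _>_)
import Data.Nat.Properties as ℕ
open import Data.Nat.Tactic.RingSolver using (solve-∀)
open import Data.Product.Base using (_×_; _,_; proj₁; proj₂)
open import Data.Sum.Base using (_⊎_; inj₁; inj₂; swap)
open import Function.Base using (_∘_; flip; const)
open import Function.Bundles using (_⇔_; mk⇔; Equivalence)
import Function.Properties.Equivalence as ⇔
open import Level using (0ℓ)
import Relation.Binary.Construct.Closure.Equivalence as Eq
open import Relation.Binary.PropositionalEquality
  using (_≡_; _≢_; refl; sym; trans; cong; cong₂; subst; subst₂; module ≡-Reasoning)
open import Relation.Nullary using (Dec; yes; no; does; contradiction)
open import Relation.Nullary.Decidable using (does-⇔; dec-true; dec-false)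
open import Relation.Unary using (Pred; Decidable)

open import Algebra.Properties.CommutativeMonoid.Sum ℕ.+-0-commutativeMonoid
  using (sum-cong-≗; ∑-distrib-+; ∑-comm; sum-init-last; sum-replicate-zero)
open import Algebra.Properties.AbelianGroup ℤ.+-0-abelianGroup using (∙-cancelʳ)
open import Algebra.Properties.Semiring.Sum ℕ.+-*-semiring using (*-distribʳ-sum)

open Equivalence using (to; from)
open ≡-Reasoning

private
  variable
    k m m′ n t V V′ : ℕ

-- Boolean entries and decisions

does-≟-true : ∀ b → does (b Bool.≟ true) ≡ b
does-≟-true false = refl
does-≟-true true  = refl

-- Turns an entry of the edge adjacency matrix into a decision about end points, so that row and
-- column sums become degrees.
does-⇔-true : ∀ {A : Set} b → b ≡ true ⇔ A → (a? : Dec A) → b ≡ does a?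
does-⇔-true b b⇔A a? = trans (sym (does-≟-true b)) (does-⇔ b⇔A (b Bool.≟ true) a?)

does⇒ : ∀ {A : Set} (a? : Dec A) → does a? ≡ true → A
does⇒ (yes a) _ = a

-- Finite sums

∑≡0⇔ : (f : Fin k → ℕ) → ∑ f ≡ 0 ⇔ (∀ i → f i ≡ 0)
∑≡0⇔ {k} f = mk⇔ (⇒ f) λ f≡0 → trans (sum-cong-≗ f≡0) (sum-replicate-zero k)
  where
  ⇒ : ∀ {k} (f : Fin k → ℕ) → ∑ f ≡ 0 → ∀ i → f i ≡ 0
  ⇒ f p zero    = ℕ.m+n≡0⇒m≡0 (f zero) p
  ⇒ f p (suc i) = ⇒ (f ∘ suc) (ℕ.m+n≡0⇒n≡0 (f zero) p) i

∑-const-1 : ∀ k → ∑ {k} (const 1) ≡ k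
∑-const-1 zero    = refl
∑-const-1 (suc k) = cong suc (∑-const-1 k)

∑-select : (x : Fin k) (f : Fin k → ℕ) → ∑ (λ v → ⟦ does (x ≟ v) ⟧ * f v) ≡ f x
∑-select {suc k} zero f = begin
  1 * f zero + ∑ {k} (const 0) ≡⟨ cong₂ _+_ (ℕ.*-identityˡ (f zero)) (sum-replicate-zero k) ⟩
  f zero + 0                   ≡⟨ ℕ.+-identityʳ (f zero) ⟩
  f zero                       ∎
∑-select (suc x) f = ∑-select x (f ∘ suc)

∑-indicator : (x : Fin k) → ∑ (λ v → ⟦ does (x ≟ v) ⟧) ≡ 1
∑-indicator x = trans (sum-cong-≗ λ v → sym (ℕ.*-identityʳ ⟦ does (x ≟ v) ⟧)) (∑-select x (const 1))

∑-indicatorˡ : (x : Fin k) → ∑ (λ v → ⟦ does (v ≟ x) ⟧) ≡ 1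
∑-indicatorˡ x =
  trans (sum-cong-≗ λ v → cong ⟦_⟧ (does-⇔ (mk⇔ sym sym) (v ≟ x) (x ≟ v))) (∑-indicator x)

-- `inDegree H` and `outDegree H` are by definition the fibre sizes of `target H` and `source H`, so
-- each fact about fibres serves both degrees.
fibreSize : (Fin m → Fin V) → Fin V → ℕ
fibreSize t v = ∑ λ e → ⟦ does (t e ≟ v) ⟧

-- Double counting: each term is spread over all v by an indicator and the order of summation is
-- exchanged. For targets and out-degrees this counts the pairs of consecutive edges by their common
-- vertex.
∑-fibres : (t : Fin m → Fin V) (h : Fin V → ℕ) → ∑ (h ∘ t) ≡ ∑ (λ v → fibreSize t v * h v)
∑-fibres t h = begin
  ∑ (λ e → h (t e))                              ≡⟨ sum-cong-≗ (λ e → ∑-select (t e) h) ⟨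
  ∑ (λ e → ∑ λ v → ⟦ does (t e ≟ v) ⟧ * h v)     ≡⟨ ∑-comm (λ e v → ⟦ does (t e ≟ v) ⟧ * h v) ⟩
  ∑ (λ v → ∑ λ e → ⟦ does (t e ≟ v) ⟧ * h v)     ≡⟨ sum-cong-≗ (λ v →
                                                      *-distribʳ-sum (h v) (λ e → ⟦ does (t e ≟ v) ⟧)) ⟨
  ∑ (λ v → fibreSize t v * h v)                  ∎

∑-fibreSize : (t : Fin m → Fin V) → ∑ (fibreSize t) ≡ m
∑-fibreSize {m} t = begin
  ∑ (fibreSize t)               ≡⟨ sum-cong-≗ (λ v → ℕ.*-identityʳ (fibreSize t v)) ⟨
  ∑ (λ v → fibreSize t v * 1)   ≡⟨ ∑-fibres t (const 1) ⟨
  ∑ {m} (const 1)               ≡⟨ ∑-const-1 m ⟩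
  m                             ∎

fibreSize≡0⇔ : (t : Fin m → Fin V) (v : Fin V) → fibreSize t v ≡ 0 ⇔ (∀ e → t e ≢ v)
fibreSize≡0⇔ t v = mk⇔
  (λ p e te≡v → contradiction
    (trans (sym (cong ⟦_⟧ (dec-true (t e ≟ v) te≡v))) (to (∑≡0⇔ _) p e)) λ ())
  (λ p → from (∑≡0⇔ _) λ e → cong ⟦_⟧ (dec-false (t e ≟ v) (p e)))

fibreSize≡1 : (t : Fin m → Fin V) (e : Fin m) → (∀ f → t f ≡ t e → f ≡ e) →
              fibreSize t (t e) ≡ 1
fibreSize≡1 t e unique = trans
  (sum-cong-≗ λ f → cong ⟦_⟧ (does-⇔ (mk⇔ (unique f) (cong t)) (t f ≟ t e) (f ≟ e)))
  (∑-indicatorˡ e)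

-- Lengths of filtered lists as sums

module _ {A : Set} {P : Pred A 0ℓ} (P? : Decidable P) where

  length-filter-tabulate : (f : Fin k → A) →
    length (filter P? (tabulate f)) ≡ ∑ λ i → ⟦ does (P? (f i)) ⟧
  length-filter-tabulate {zero}  f = refl
  length-filter-tabulate {suc k} f with does (P? (f zero))
  ... | true  = cong suc (length-filter-tabulate (f ∘ suc))
  ... | false = length-filter-tabulate (f ∘ suc)

module _ {A B : Set} {P : Pred (A × B) 0ℓ} (P? : Decidable P) where

  -- General `f` and `g` in place of `allFin` make the induction on `k` possible, since its step
  -- passes to `f ∘ suc`.
  length-filter-cartesianProduct : (f : Fin k → A) (g : Fin m → B) →
    length (filter P? (cartesianProduct (tabulate f) (tabulate g)))
    ≡ ∑ λ i → ∑ λ j → ⟦ does (P? (f i , g j)) ⟧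
  length-filter-cartesianProduct {zero}  f g = refl
  length-filter-cartesianProduct {suc k} f g = begin
    length (filter P? (map (f zero ,_) (tabulate g) ++ rest))
      ≡⟨ cong length (filter-++ P? (map (f zero ,_) (tabulate g)) rest) ⟩
    length (filter P? (map (f zero ,_) (tabulate g)) ++ filter P? rest)
      ≡⟨ length-++ (filter P? (map (f zero ,_) (tabulate g))) ⟩
    length (filter P? (map (f zero ,_) (tabulate g))) + length (filter P? rest)
      ≡⟨ cong (λ xs → length (filter P? xs) + length (filter P? rest)) (map-tabulate g (f zero ,_)) ⟩
    length (filter P? (tabulate ((f zero ,_) ∘ g))) + length (filter P? rest)
      ≡⟨ cong₂ _+_ (length-filter-tabulate P? ((f zero ,_) ∘ g))
                   (length-filter-cartesianProduct (f ∘ suc) g) ⟩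
    (∑ λ i → ∑ λ j → ⟦ does (P? (f i , g j)) ⟧) ∎
    where
    rest = cartesianProduct (tabulate (f ∘ suc)) (tabulate g)

length-ones : (M : Matrix k) → length (ones M) ≡ ∑ (rowSum M)
length-ones M = trans
  (length-filter-cartesianProduct (λ (i , j) → M i j Bool.≟ true) (λ i → i) (λ j → j))
  (sum-cong-≗ λ i → sum-cong-≗ λ j → cong ⟦_⟧ (does-≟-true (M i j)))

-- Connected components and the cyclomatic number

-- Each component of `G` is represented by a vertex, which is sent through `f` and labelled in `G′`.
-- Reflection of joinedness makes this map of labels injective.
count-≤ : {G : Digraph V m} {G′ : Digraph V′ m′} (K : Components G) (K′ : Components G′)
          (f : Fin V → Fin V′) → (∀ {u v} → Joined G′ (f u) (f v) → Joined G u v) →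
          Components.count K ≤ Components.count K′
count-≤ K K′ f reflects = injective⇒≤ {f = λ x → K′.label (f (representative x))} λ {x} {y} p →
  trans (sym (proj₂ (K.label-surjective x)))
    (trans (from (K.label-correct _ _) (reflects (to (K′.label-correct _ _) p)))
      (proj₂ (K.label-surjective y)))
  where
  module K  = Components K
  module K′ = Components K′
  representative = λ x → proj₁ (K.label-surjective x)

module _ (G : Digraph V m) (G′ : Digraph V′ m′)
         (f : Fin V → Fin V′) (g : Fin V′ → Fin V)
         (f-edge : ∀ {u v} → Adjacent G u v → Joined G′ (f u) (f v))
         (g-edge : ∀ {u v} → Adjacent G′ u v → Joined G (g u) (g v))
         (gf : ∀ u → Joined G (g (f u)) u)
         (fg : ∀ v → Joined G′ (f (g v)) v) where

  -- Both maps reflect joinedness: if `f u` and `f v` are joined, so are `g (f u)` and `g (f v)`,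
  -- and these are joined to `u` and `v`. Preservation needs checking on single edges only.
  count-≡ : Components.count (components G) ≡ Components.count (components G′)
  count-≡ = ℕ.≤-antisym
    (count-≤ (components G) (components G′) f λ {u} {v} p →
      Eq.transitive _ (Eq.symmetric _ (gf u))
        (Eq.transitive _ (Eq.gfold (Eq.isEquivalence _) g g-edge p) (gf v)))
    (count-≤ (components G′) (components G) g λ {u} {v} p →
      Eq.transitive _ (Eq.symmetric _ (fg u))
        (Eq.transitive _ (Eq.gfold (Eq.isEquivalence _) f f-edge p) (fg v)))

minus-≡⇔ : ∀ a b a′ b′ → a ℤ.- b ≡ a′ ℤ.- b′ ⇔ a ℤ.+ b′ ≡ a′ ℤ.+ b
minus-≡⇔ a b a′ b′ = mk⇔
  (λ p → begin
    a ℤ.+ b′                     ≡⟨ move a b b′ ⟩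
    (a ℤ.- b) ℤ.+ (b ℤ.+ b′)     ≡⟨ cong (ℤ._+ (b ℤ.+ b′)) p ⟩
    (a′ ℤ.- b′) ℤ.+ (b ℤ.+ b′)   ≡⟨ cong (ℤ._+_ (a′ ℤ.- b′)) (ℤ.+-comm b b′) ⟩
    (a′ ℤ.- b′) ℤ.+ (b′ ℤ.+ b)   ≡⟨ move a′ b′ b ⟨
    a′ ℤ.+ b                     ∎)
  (λ p → begin
    a ℤ.- b                      ≡⟨ cancel a b b′ ⟩
    (a ℤ.+ b′) ℤ.- (b ℤ.+ b′)    ≡⟨ cong (ℤ._- (b ℤ.+ b′)) p ⟩
    (a′ ℤ.+ b) ℤ.- (b ℤ.+ b′)    ≡⟨ cong (ℤ._-_ (a′ ℤ.+ b)) (ℤ.+-comm b b′) ⟩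
    (a′ ℤ.+ b) ℤ.- (b′ ℤ.+ b)    ≡⟨ cancel a′ b′ b ⟨
    a′ ℤ.- b′                    ∎)
  where
  move : ∀ x y z → x ℤ.+ z ≡ (x ℤ.- y) ℤ.+ (y ℤ.+ z)
  move = ℤ-Solver.solve-∀

  cancel : ∀ x y z → x ℤ.- y ≡ (x ℤ.+ z) ℤ.- (y ℤ.+ z)
  cancel = ℤ-Solver.solve-∀

-- The component counts cancel. Moving the numbers of vertices to the opposite sides leaves an
-- equation in ℕ without subtraction.
ν-≡⇔ : (G : Digraph V m) (G′ : Digraph V′ m′) →
       Components.count (components G) ≡ Components.count (components G′) →
       ν G ≡ ν G′ ⇔ m + V′ ≡ m′ + V
ν-≡⇔ {V} {m} {V′} {m′} G G′ c≡c′ = mk⇔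
  (λ p → ℤ.+-injective (to minus (∙-cancelʳ _ _ _
    (trans p (cong (λ c → ℤ.+ m′ ℤ.- ℤ.+ V′ ℤ.+ ℤ.+ c) (sym c≡c′))))))
  (λ p → cong₂ ℤ._+_ (from minus (cong ℤ.+_ p)) (cong ℤ.+_ c≡c′))
  where
  minus = minus-≡⇔ (ℤ.+ m) (ℤ.+ V) (ℤ.+ m′) (ℤ.+ V′)

-- Vertex graphs and the Δn-transformation

-- An edge of `vertexGraph M` is a position in the list `ones M`, so the index of a membership proof
-- supplies the edge.
adjacent⇔one : (M : Matrix k) → ∀ {u v} → Adjacent (vertexGraph M) u v ⇔ M u v ≡ true
adjacent⇔one {k} M {u} {v} = mk⇔
  (λ (e , p , q) → subst₂ (λ i j → M i j ≡ true) p q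
    (proj₂ (∈-filter⁻ one? {xs = cartesianProduct (allFin k) (allFin k)} (∈-lookup {xs = ones M} e))))
  (λ Muv → let uv∈ = ∈-filter⁺ one? (∈-cartesianProduct⁺ (∈-allFin u) (∈-allFin v)) Muv in
    index uv∈ , sym (cong proj₁ (lookup-index uv∈)) , sym (cong proj₂ (lookup-index uv∈)))
  where
  one? : Decidable (λ (i , j) → M i j ≡ true)
  one? (i , j) = M i j Bool.≟ true

one⇒joined : (M : Matrix k) → ∀ {u v} → M u v ≡ true → Joined (vertexGraph M) u v
one⇒joined M = Eq.return ∘ from (adjacent⇔one M)

module Subdivision (M : Matrix k) (x y : Fin k) (Mxy : M x y ≡ true) where

  D : Matrix (suc k)
  D = Δn M x y

  old : Fin k → Fin k → Bool
  old i j = M i j ∧ not (does (i ≟ x) ∧ does (j ≟ y))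

  D-old : ∀ i j → D (inject₁ i) (inject₁ j) ≡ old i j
  D-old i j rewrite view-inject₁ i | view-inject₁ j = refl

  D-column : ∀ i → D (inject₁ i) (fromℕ k) ≡ does (i ≟ x)
  D-column i rewrite view-inject₁ i | view-fromℕ k = refl

  D-row : ∀ j → D (fromℕ k) (inject₁ j) ≡ does (j ≟ y)
  D-row j rewrite view-fromℕ k | view-inject₁ j = refl

  D-corner : D (fromℕ k) (fromℕ k) ≡ false
  D-corner rewrite view-fromℕ k = refl

  -- The cleared entry is added back instead of being subtracted from `M`, which keeps the count
  -- within ℕ; at `(x , y)` it relies on `Mxy`.
  old-indicator : ∀ i j → ⟦ old i j ⟧ + ⟦ does (i ≟ x) ⟧ * ⟦ does (j ≟ y) ⟧ ≡ ⟦ M i j ⟧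
  old-indicator i j with i ≟ x | j ≟ y
  ... | yes refl | yes refl rewrite Mxy = refl
  ... | yes _    | no _     rewrite Bool.∧-identityʳ (M i j) = ℕ.+-identityʳ _
  ... | no _     | _        rewrite Bool.∧-identityʳ (M i j) = ℕ.+-identityʳ _

  ∑∑old : ℕ
  ∑∑old = ∑ λ i → ∑ λ j → ⟦ old i j ⟧

  suc-∑∑old : suc ∑∑old ≡ ∑ (rowSum M)
  suc-∑∑old = begin
    suc ∑∑old
      ≡⟨ ℕ.+-comm 1 ∑∑old ⟩
    ∑∑old + 1
      ≡⟨ cong (∑∑old +_) ∑∑δ ⟨
    ∑∑old + (∑ λ i → ∑ λ j → δ i j)
      ≡⟨ ∑-distrib-+ (λ i → ∑ λ j → ⟦ old i j ⟧) (λ i → ∑ λ j → δ i j) ⟨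
    (∑ λ i → (∑ λ j → ⟦ old i j ⟧) + (∑ λ j → δ i j))
      ≡⟨ sum-cong-≗ (λ i → trans (sym (∑-distrib-+ (λ j → ⟦ old i j ⟧) (δ i)))
                                 (sum-cong-≗ (old-indicator i))) ⟩
    ∑ (rowSum M) ∎
    where
    δ : Fin k → Fin k → ℕ
    δ i j = ⟦ does (i ≟ x) ⟧ * ⟦ does (j ≟ y) ⟧

    ∑∑δ : (∑ λ i → ∑ λ j → δ i j) ≡ 1
    ∑∑δ = begin
      (∑ λ i → ∑ λ j → δ i j)
        ≡⟨ ∑-comm δ ⟩
      (∑ λ j → ∑ λ i → δ i j)
        ≡⟨ sum-cong-≗ (λ j → *-distribʳ-sum ⟦ does (j ≟ y) ⟧ (λ i → ⟦ does (i ≟ x) ⟧)) ⟨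
      (∑ λ j → (∑ λ i → ⟦ does (i ≟ x) ⟧) * ⟦ does (j ≟ y) ⟧)
        ≡⟨ sum-cong-≗ (λ j → trans (cong (_* ⟦ does (j ≟ y) ⟧) (∑-indicatorˡ x)) (ℕ.*-identityˡ _)) ⟩
      (∑ λ j → ⟦ does (j ≟ y) ⟧)
        ≡⟨ ∑-indicatorˡ y ⟩
      1 ∎

  -- The old block loses one entry, while the new column and the new row gain one each.
  ∑rowSum : ∑ (rowSum D) ≡ suc (∑ (rowSum M))
  ∑rowSum = begin
    ∑ (rowSum D)
      ≡⟨ sum-init-last (rowSum D) ⟩
    ∑ (rowSum D ∘ inject₁) + rowSum D (fromℕ k)
      ≡⟨ cong₂ _+_ oldRows newRow ⟩
    ∑∑old + 1 + 1
      ≡⟨ ℕ.+-comm (∑∑old + 1) 1 ⟩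
    suc (∑∑old + 1)
      ≡⟨ cong suc (trans (ℕ.+-comm ∑∑old 1) suc-∑∑old) ⟩
    suc (∑ (rowSum M)) ∎
    where
    oldRow : ∀ i → rowSum D (inject₁ i) ≡ (∑ λ j → ⟦ old i j ⟧) + ⟦ does (i ≟ x) ⟧
    oldRow i = trans (sum-init-last (λ b → ⟦ D (inject₁ i) b ⟧))
      (cong₂ _+_ (sum-cong-≗ λ j → cong ⟦_⟧ (D-old i j)) (cong ⟦_⟧ (D-column i)))

    oldRows : ∑ (rowSum D ∘ inject₁) ≡ ∑∑old + 1
    oldRows = begin
      ∑ (rowSum D ∘ inject₁)
        ≡⟨ sum-cong-≗ oldRow ⟩
      (∑ λ i → (∑ λ j → ⟦ old i j ⟧) + ⟦ does (i ≟ x) ⟧)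
        ≡⟨ ∑-distrib-+ (λ i → ∑ λ j → ⟦ old i j ⟧) (λ i → ⟦ does (i ≟ x) ⟧) ⟩
      ∑∑old + (∑ λ i → ⟦ does (i ≟ x) ⟧)
        ≡⟨ cong (∑∑old +_) (∑-indicatorˡ x) ⟩
      ∑∑old + 1 ∎

    newRow : rowSum D (fromℕ k) ≡ 1
    newRow = trans (sum-init-last (λ b → ⟦ D (fromℕ k) b ⟧))
      (cong₂ _+_ (trans (sum-cong-≗ λ j → cong ⟦_⟧ (D-row j)) (∑-indicatorˡ y))
                 (cong ⟦_⟧ D-corner))

  -- The new vertex is merged with `x`: the edge entering it shrinks to a point, and the edge
  -- leaving it becomes the old edge from `x` to `y`.
  collapse : Fin (suc k) → Fin k
  collapse a with view a
  ... | ‵inject₁ i = i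
  ... | ‵fromℕ     = x

  collapse-inject₁ : ∀ i → collapse (inject₁ i) ≡ i
  collapse-inject₁ i rewrite view-inject₁ i = refl

  enter : Joined (vertexGraph D) (inject₁ x) (fromℕ k)
  enter = one⇒joined D (trans (D-column x) (dec-true (x ≟ x) refl))

  leave : Joined (vertexGraph D) (fromℕ k) (inject₁ y)
  leave = one⇒joined D (trans (D-row y) (dec-true (y ≟ y) refl))

  inject₁-edge : ∀ {u v} → M u v ≡ true → Joined (vertexGraph D) (inject₁ u) (inject₁ v)
  inject₁-edge {u} {v} Muv with u ≟ x | v ≟ y | D-old u v
  -- The subdivided edge is replaced by the path through the new vertex.
  ... | yes refl | yes refl | _ = Eq.transitive _ enter leave
  ... | yes _    | no _     | p = one⇒joined D (trans p (cong (_∧ true) Muv))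
  ... | no _     | _        | p = one⇒joined D (trans p (cong (_∧ true) Muv))

  collapse-edge : ∀ a b → D a b ≡ true → Joined (vertexGraph M) (collapse a) (collapse b)
  collapse-edge a b Dab with view a | view b
  ... | ‵inject₁ i | ‵inject₁ j = one⇒joined M (Bool.∧-conicalˡ (M i j) _ Dab)
  ... | ‵inject₁ i | ‵fromℕ     rewrite does⇒ (i ≟ x) Dab = Eq.reflexive _
  ... | ‵fromℕ     | ‵inject₁ j rewrite does⇒ (j ≟ y) Dab = one⇒joined M Mxy

  inject₁-collapse : ∀ a → Joined (vertexGraph D) (inject₁ (collapse a)) a
  inject₁-collapse a with view a
  ... | ‵inject₁ i = Eq.reflexive _
  ... | ‵fromℕ     = enter

  ν-Δn : ν (vertexGraph D) ≡ ν (vertexGraph M)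
  ν-Δn = from (ν-≡⇔ (vertexGraph D) (vertexGraph M) same-count) (begin
    length (ones D) + k             ≡⟨ cong (_+ k) (trans (length-ones D) ∑rowSum) ⟩
    suc (∑ (rowSum M)) + k          ≡⟨ ℕ.+-suc _ k ⟨
    ∑ (rowSum M) + suc k            ≡⟨ cong (_+ suc k) (length-ones M) ⟨
    length (ones M) + suc k         ∎)
    where
    same-count = count-≡ (vertexGraph D) (vertexGraph M) collapse inject₁
      (λ {a} {b} → collapse-edge a b ∘ to (adjacent⇔one D))
      (inject₁-edge ∘ to (adjacent⇔one M))
      inject₁-collapse
      (λ i → subst (λ j → Joined (vertexGraph M) j i) (sym (collapse-inject₁ i)) (Eq.reflexive _))

ν-ΔnSequence : {E : Matrix n} {M : Matrix (t + n)} → ΔnSequence E t M →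
               ν (vertexGraph M) ≡ ν (vertexGraph E)
ν-ΔnSequence start                     = refl
ν-ΔnSequence (step E⇝M x y (Mxy , _)) =
  trans (Subdivision.ν-Δn _ x y Mxy) (ν-ΔnSequence E⇝M)

-- Edge graphs

-- Reversal exchanges in-degrees with out-degrees and transposes `R`, so a result on initial
-- vertices also yields the one on final vertices.
reverse : Digraph V m → Digraph V m
reverse H = record { source = target H ; target = source H }

reverse-isEdgeGraph : {R : Matrix m} {H : Digraph V m} →
                      IsEdgeGraph R H → IsEdgeGraph (flip R) (reverse H)
reverse-isEdgeGraph H-edge = record
  { adjacency      = λ i j → ⇔.trans (adjacency j i) (mk⇔ sym sym)
  ; noIsolated     = λ v → let e , p = noIsolated v in e , swap p
  ; initialPrivate = λ j z e p → finalPrivate j z e (swap p)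
  ; finalPrivate   = λ i z e p → initialPrivate i z e (swap p)
  }
  where
  open IsEdgeGraph H-edge

-- Some edge is incident to `v` and cannot end there, so it begins there. Its column in `R` is
-- empty, and privacy of initial vertices excludes any other edge leaving `v`.
initial⇒outDegree≡1 : {R : Matrix m} {H : Digraph V m} → IsEdgeGraph R H →
                      ∀ v → inDegree H v ≡ 0 → outDegree H v ≡ 1
initial⇒outDegree≡1 {R = R} {H} H-edge v in≡0 with IsEdgeGraph.noIsolated H-edge v
... | e , inj₂ te≡v = contradiction te≡v (to (fibreSize≡0⇔ (target H) v) in≡0 e)
... | e , inj₁ refl = fibreSize≡1 (source H) e λ f sf≡se → initialPrivate e emptyColumn f (inj₁ sf≡se)
  where
  open IsEdgeGraph H-edge

  emptyColumn : ∀ i → R i e ≡ false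
  emptyColumn i = Bool.¬-not λ Rie →
    to (fibreSize≡0⇔ (target H) (source H e)) in≡0 i (to (adjacency i e) Rie)

-- For positive degrees this is the expansion of (m - 1)(n - 1). If one degree is 0, the other is 1,
-- and both sides equal 1.
m*n+1≡m+n+pred : ∀ m n → (m ≡ 0 → n ≡ 1) → (n ≡ 0 → m ≡ 1) →
                 m * n + 1 ≡ (m + n) + pred m * pred n
m*n+1≡m+n+pred zero    n       m≡0⇒ n≡0⇒ rewrite m≡0⇒ refl = refl
m*n+1≡m+n+pred (suc m) zero    m≡0⇒ n≡0⇒ rewrite ℕ.suc-injective (n≡0⇒ refl) = refl
m*n+1≡m+n+pred (suc m) (suc n) _    _    = expand m n
  where
  expand : ∀ m n → suc m * suc n + 1 ≡ (suc m + suc n) + m * n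
  expand = solve-∀

pred≡0⇒ : ∀ n → pred n ≡ 0 → n ≡ 0 ⊎ n ≡ 1
pred≡0⇒ zero    _ = inj₁ refl
pred≡0⇒ (suc n) p = inj₂ (cong suc p)

module EdgeGraph {R : Matrix m} {H : Digraph V m} (H-edge : IsEdgeGraph R H) where

  open IsEdgeGraph H-edge

  -- Truncation in `pred` is harmless: where one degree is 0 the other is 1, so (in - 1)(out - 1)
  -- vanishes as well.
  din dout excess : Fin V → ℕ
  din      = inDegree H
  dout     = outDegree H
  excess v = pred (din v) * pred (dout v)

  rowSum≡outDegree : ∀ i → rowSum R i ≡ dout (target H i)
  rowSum≡outDegree i = sum-cong-≗ λ j → cong ⟦_⟧
    (does-⇔-true (R i j) (⇔.trans (adjacency i j) (mk⇔ sym sym)) (source H j ≟ target H i))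

  colSum≡inDegree : ∀ j → colSum R j ≡ din (source H j)
  colSum≡inDegree j = sum-cong-≗ λ i → cong ⟦_⟧
    (does-⇔-true (R i j) (adjacency i j) (target H i ≟ source H j))

  ones+vertices : length (ones R) + V ≡ (m + m) + ∑ excess
  ones+vertices = begin
    length (ones R) + V
      ≡⟨ cong₂ _+_
           (trans (length-ones R) (trans (sum-cong-≗ rowSum≡outDegree) (∑-fibres (target H) dout)))
           -- `V` becomes a sum of ones, so that the degree identity can be applied vertex by
           -- vertex.
           (sym (∑-const-1 V)) ⟩
    (∑ λ v → din v * dout v) + ∑ {V} (const 1)
      ≡⟨ ∑-distrib-+ (λ v → din v * dout v) (const 1) ⟨
    (∑ λ v → din v * dout v + 1)
      ≡⟨ sum-cong-≗ (λ v → m*n+1≡m+n+pred (din v) (dout v)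
           (initial⇒outDegree≡1 H-edge v)
           (initial⇒outDegree≡1 (reverse-isEdgeGraph H-edge) v)) ⟩
    (∑ λ v → (din v + dout v) + excess v)
      ≡⟨ ∑-distrib-+ (λ v → din v + dout v) excess ⟩
    (∑ λ v → din v + dout v) + ∑ excess
      ≡⟨ cong (_+ ∑ excess) (trans (∑-distrib-+ din dout)
           (cong₂ _+_ (∑-fibreSize (target H)) (∑-fibreSize (source H)))) ⟩
    (m + m) + ∑ excess ∎

  -- The edges of `H` are the vertices of `vertexGraph R`.
  _~_ : Fin m → Fin m → Set
  _~_ = Joined (vertexGraph R)

  consecutive : ∀ {i j} → target H i ≡ source H j → i ~ j
  consecutive {i} {j} = one⇒joined R ∘ from (adjacency i j)

  -- A common source is either the end of a third edge, adjacent to both, or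
  -- an initial vertex, which is private.
  incident⇒joined : ∀ {v i j} → Incident H i v → Incident H j v → i ~ j
  incident⇒joined (inj₂ refl) (inj₁ q) = consecutive (sym q)
  incident⇒joined (inj₁ refl) (inj₂ q) = Eq.symmetric _ (consecutive q)
  incident⇒joined {i = i} {j} (inj₁ refl) (inj₁ q) with any? (λ h → R h i Bool.≟ true)
  ... | yes (h , Rhi) = Eq.transitive _ (Eq.symmetric _ (one⇒joined R Rhi))
                          (consecutive (trans (to (adjacency h i) Rhi) (sym q)))
  ... | no none
    rewrite initialPrivate i (λ h → Bool.¬-not (λ p → none (h , p))) j (inj₁ q) = Eq.reflexive _
  incident⇒joined {i = i} {j} (inj₂ refl) (inj₂ q) with any? (λ h → R i h Bool.≟ true)
  ... | yes (h , Rih) = Eq.transitive _ (one⇒joined R Rih)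
                          (Eq.symmetric _ (consecutive (trans q (to (adjacency i h) Rih))))
  ... | no none
    rewrite finalPrivate i (λ h → Bool.¬-not (λ p → none (h , p))) j (inj₂ q) = Eq.reflexive _

  edgeAt : Fin V → Fin m
  edgeAt v = proj₁ (noIsolated v)

  target-edgeAt : ∀ v → Joined H (target H (edgeAt v)) v
  target-edgeAt v with noIsolated v
  ... | e , inj₁ refl = Eq.symmetric _ (Eq.return (e , refl , refl))
  ... | e , inj₂ refl = Eq.reflexive _

  -- A vertex goes to some incident edge, an edge to its end. All edges at one vertex are joined, so
  -- the choice of the incident edge does not matter.
  same-count : Components.count (components H) ≡ Components.count (components (vertexGraph R))
  same-count = count-≡ H (vertexGraph R) edgeAt (target H)
    (λ { {u} {v} (e , p , q) → Eq.transitive _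
      (incident⇒joined (proj₂ (noIsolated u)) (inj₁ p))
      (incident⇒joined (inj₂ q) (proj₂ (noIsolated v))) })
    -- Edge `j` itself leads from the end of `i` to the end of `j`.
    (λ { {i} {j} a → Eq.return (j , sym (to (adjacency i j) (to (adjacent⇔one R) a)) , refl) })
    target-edgeAt
    (λ i → incident⇒joined (proj₂ (noIsolated (target H i))) (inj₂ refl))

  ν-≡⇔excess≡0 : ν H ≡ ν (vertexGraph R) ⇔ (∀ v → excess v ≡ 0)
  ν-≡⇔excess≡0 = ⇔.trans (ν-≡⇔ H (vertexGraph R) same-count) (⇔.trans
    -- As `vertexGraph R` has `m` vertices, the equation to compare is
    -- `m + m ≡ length (ones R) + V`, and by `ones+vertices` its sides differ by `∑ excess`.
    (mk⇔ (λ p → ℕ.+-cancelˡ-≡ (m + m) _ 0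
           (trans (sym ones+vertices) (trans (sym p) (sym (ℕ.+-identityʳ (m + m))))))
         (λ p → sym (trans ones+vertices (trans (cong (m + m +_) p) (ℕ.+-identityʳ _)))))
    (∑≡0⇔ excess))

  -- A product vanishes when a factor does, and `pred` vanishes exactly at 0 and 1; this gives the
  -- four alternatives of `Simple`.
  simple⇔excess≡0 : ∀ v → Simple H v ⇔ excess v ≡ 0
  simple⇔excess≡0 v = mk⇔ ⇒ ⇐
    where
    ⇒ : Simple H v → excess v ≡ 0
    ⇒ (inj₁ in≡0)               rewrite in≡0  = refl
    ⇒ (inj₂ (inj₁ out≡0))        rewrite out≡0 = ℕ.*-zeroʳ (pred (din v))
    ⇒ (inj₂ (inj₂ (inj₁ in≡1)))  rewrite in≡1  = refl
    ⇒ (inj₂ (inj₂ (inj₂ out≡1))) rewrite out≡1 = ℕ.*-zeroʳ (pred (din v))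

    ⇐ : excess v ≡ 0 → Simple H v
    ⇐ p with ℕ.m*n≡0⇒m≡0∨n≡0 (pred (din v)) p
    ⇐ p | inj₁ q with pred≡0⇒ (din v) q
    ... | inj₁ in≡0 = inj₁ in≡0
    ... | inj₂ in≡1 = inj₂ (inj₂ (inj₁ in≡1))
    ⇐ p | inj₂ q with pred≡0⇒ (dout v) q
    ... | inj₁ out≡0 = inj₂ (inj₁ out≡0)
    ... | inj₂ out≡1 = inj₂ (inj₂ (inj₂ out≡1))

  BranchesOnce : Fin m → Fin m → Set
  BranchesOnce x y = (colSum R y > 1 → rowSum R x ≡ 1) × (rowSum R x > 1 → colSum R y ≡ 1)

  -- A one of `R` at `(x , y)` is a passage from `x` to `y` through a vertex whose in-degree is
  -- `colSum R y` and whose out-degree is `rowSum R x`.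
  simple⇔branchesOnce : (∀ v → Simple H v) ⇔ (∀ x y → R x y ≡ true → BranchesOnce x y)
  simple⇔branchesOnce = mk⇔ ⇒ ⇐
    where
    ⇒ : (∀ v → Simple H v) → ∀ x y → R x y ≡ true → BranchesOnce x y
    ⇒ simple x y Rxy
      rewrite rowSum≡outDegree x | colSum≡inDegree y | to (adjacency x y) Rxy
      with simple (source H y)
    ... | inj₁ in≡0               =
      contradiction (to (adjacency x y) Rxy) (to (fibreSize≡0⇔ (target H) _) in≡0 x)
    ... | inj₂ (inj₁ out≡0)        = contradiction refl (to (fibreSize≡0⇔ (source H) _) out≡0 y)
    ... | inj₂ (inj₂ (inj₁ in≡1))  = (λ in>1 → contradiction (sym in≡1) (ℕ.<⇒≢ in>1)) , const in≡1
    ... | inj₂ (inj₂ (inj₂ out≡1)) = const out≡1 , λ out>1 → contradiction (sym out≡1) (ℕ.<⇒≢ out>1)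

    ⇐ : (∀ x y → R x y ≡ true → BranchesOnce x y) → ∀ v → Simple H v
    -- Without an edge ending or an edge beginning at `v`, the vertex is initial or final. Otherwise
    -- two such edges give a one of `R`, to which `branches` applies once the in-degree exceeds 1.
    ⇐ branches v with any? (λ x → target H x ≟ v) | any? (λ y → source H y ≟ v) | din v ℕ.≟ 1
    ... | no none        | _               | _        =
      inj₁ (from (fibreSize≡0⇔ (target H) v) λ x p → none (x , p))
    ... | yes _          | no none         | _        =
      inj₂ (inj₁ (from (fibreSize≡0⇔ (source H) v) λ y p → none (y , p)))
    ... | yes _          | yes _           | yes in≡1 = inj₂ (inj₂ (inj₁ in≡1))
    ... | yes (x , refl) | yes (y , sy≡tx) | no in≢1  =
      inj₂ (inj₂ (inj₂ (trans (sym (rowSum≡outDegree x)) (proj₁ (branches x y Rxy) in>1))))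
      where
      Rxy : R x y ≡ true
      Rxy = from (adjacency x y) (sym sy≡tx)

      in>1 : colSum R y > 1
      in>1 = subst (_> 1) (sym (trans (colSum≡inDegree y) (cong din sy≡tx)))
        (ℕ.≤∧≢⇒< (ℕ.n≢0⇒n>0 λ in≡0 → to (fibreSize≡0⇔ (target H) _) in≡0 x refl) (in≢1 ∘ sym))

theorem4 : (n : ℕ) (E : Matrix n) (s_q : ℕ) (R : Matrix (s_q + n)) →
    Quasinormalization E s_q R →
    (V : ℕ) (H_q : Digraph V (s_q + n)) → IsEdgeGraph R H_q → Connected H_q →
    (ν H_q ≡ ν (vertexGraph E) ⇔ (∀ v → Simple H_q v))
    × ((∀ v → Simple H_q v) ⇔
    (∀ x y → R x y ≡ true →
    (colSum R y > 1 → rowSum R x ≡ 1) × (rowSum R x > 1 → colSum R y ≡ 1)))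
theorem4 n E s_q R (E⇝R , _) V H_q H-edge _ =
  ⇔.trans
    (subst (λ z → ν H_q ≡ z ⇔ (∀ v → excess v ≡ 0)) (ν-ΔnSequence E⇝R) ν-≡⇔excess≡0)
    (mk⇔ (λ p v → from (simple⇔excess≡0 v) (p v)) (λ p v → to (simple⇔excess≡0 v) (p v)))
  , simple⇔branchesOnce
  where
  open EdgeGraph H-edge
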